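{- Let $k$ and $d$ be positive integers with $k\geq 2d$, and let $G^d_k$ be the circular clique graph. Then $\chi(G^d_k)\geq box(G^d_k)$.
   Context: The circular clique $G^d_k$ (for positive integers $k\ge 2d$) is the simple graph with vertex set $\{a_j : 0\leq j\leq k-1\}$ in which $a_ia_j$ is an edge if and only if $d\leq |i-j|\leq k-d$. $\chi(G)$ denotes the chromatic number. An $\ell$-box is a Cartesian product $[x_1,y_1]\times\cdots\times[x_\ell,y_\ell]$ of $\ell$ closed bounded real intervals; the boxicity $box(G)$ of a graph $G$ is the least positive integer $\ell$ such that $G$ is isomorphic to the intersection graph of a family of $\ell$-boxes (vertices are boxes, adjacent iff the boxes intersect). -}

module Defs where

open import Level using (Level; _⊔_; 0ℓ) renaming (suc to lsuc)
open import Data.Nat using (ℕ; _∸_; _≤_; NonZero; ∣_-_∣; ≢-nonZero⁻¹)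
open import Data.Nat.Properties using (∣-∣-comm; ∣n-n∣≡0; n≤0⇒n≡0)
open import Data.Fin using (Fin; toℕ)
open import Data.Rational as ℚ using (ℚ)
open import Data.Product using (Σ-syntax; ∃-syntax; _×_; _,_)
open import Data.Sum using (_⊎_)
open import Function using (_⇔_; _↔_; Inverse)
open import Relation.Nullary using (¬_)
open import Relation.Unary using (Pred)
open import Relation.Binary.PropositionalEquality
  using (_≢_; refl; sym; subst)

private variable
  a b c e : Level

IsLeast : Pred ℕ a → ℕ → Set a
IsLeast P n = P n × (∀ m → P m → n ≤ m)

------------------------------------------------------------------------
-- Real numbers

-- Two-sided Dedekind cuts of ℚ: Lower q means q < x and Upper q means x < q.

record ℝ : Set₁ where
  field
    Lower Upper     : Pred ℚ 0ℓ
    lower-inhabited : ∃[ q ] Lower q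
    upper-inhabited : ∃[ q ] Upper q
    lower-rounded   : ∀ q → Lower q ⇔ (∃[ r ] (q ℚ.< r × Lower r))
    upper-rounded   : ∀ q → Upper q ⇔ (∃[ r ] (r ℚ.< q × Upper r))
    disjoint        : ∀ q → ¬ (Lower q × Upper q)
    located         : ∀ {q r} → q ℚ.< r → Lower q ⊎ Upper r

infix 4 _≤ᴿ_

_≤ᴿ_ : ℝ → ℝ → Set
x ≤ᴿ y = ∀ q → ℝ.Lower x q → ℝ.Lower y q

------------------------------------------------------------------------
-- Graphs

record SimpleGraph (a e : Level) : Set (lsuc (a ⊔ e)) where
  field
    Vertex     : Set a
    Adj        : Vertex → Vertex → Set e
    adj-sym    : ∀ {u v} → Adj u v → Adj v u
    adj-irrefl : ∀ {u} → ¬ Adj u u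

open SimpleGraph

_≅_ : SimpleGraph a e → SimpleGraph b c → Set (a ⊔ e ⊔ b ⊔ c)
G ≅ H = Σ[ f ∈ Vertex G ↔ Vertex H ]
  (∀ u v → Adj G u v ⇔ Adj H (Inverse.to f u) (Inverse.to f v))

Colorable : SimpleGraph a e → ℕ → Set (a ⊔ e)
Colorable G n = Σ[ f ∈ (Vertex G → Fin n) ] (∀ u v → Adj G u v → f u ≢ f v)

IsChromaticNumber : SimpleGraph a e → ℕ → Set (a ⊔ e)
IsChromaticNumber G = IsLeast (Colorable G)

circularClique : (k d : ℕ) .{{_ : NonZero d}} → SimpleGraph 0ℓ 0ℓ
circularClique k d = record
  { Vertex     = Fin k
  ; Adj        = λ i j → d ≤ ∣ toℕ i - toℕ j ∣ × ∣ toℕ i - toℕ j ∣ ≤ k ∸ d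
  ; adj-sym    = λ {i} {j} →
      subst (λ n → d ≤ n × n ≤ k ∸ d) (∣-∣-comm (toℕ i) (toℕ j))
  ; adj-irrefl = λ { {i} (d≤ , _) →
      ≢-nonZero⁻¹ d (n≤0⇒n≡0 (subst (d ≤_) (∣n-n∣≡0 (toℕ i)) d≤)) }
  }

------------------------------------------------------------------------
-- Boxicity

record Interval : Set₁ where
  field
    lo hi : ℝ
    lo≤hi : lo ≤ᴿ hi

_∈ᴵ_ : ℝ → Interval → Set
x ∈ᴵ I = Interval.lo I ≤ᴿ x × x ≤ᴿ Interval.hi I

Box : ℕ → Set₁
Box ℓ = Fin ℓ → Interval

_∈ᴮ_ : ∀ {ℓ} → (Fin ℓ → ℝ) → Box ℓ → Set
p ∈ᴮ B = ∀ i → p i ∈ᴵ B i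

Intersect : ∀ {ℓ} → Box ℓ → Box ℓ → Set₁
Intersect B C = ∃[ p ] (p ∈ᴮ B × p ∈ᴮ C)

-- Members of the family are told apart by their index, so repeated boxes
-- give distinct (adjacent) vertices.

intersectionGraph : ∀ {ℓ} {I : Set} → (I → Box ℓ) → SimpleGraph 0ℓ (lsuc 0ℓ)
intersectionGraph {I = I} B = record
  { Vertex     = I
  ; Adj        = λ u v → u ≢ v × Intersect (B u) (B v)
  ; adj-sym    = λ (u≢v , p , p∈u , p∈v) →
      (λ v≡u → u≢v (sym v≡u)) , p , p∈v , p∈u
  ; adj-irrefl = λ (u≢u , _) → u≢u refl
  }

HasBoxRepresentation : SimpleGraph a e → ℕ → Set (lsuc 0ℓ ⊔ a ⊔ e)
HasBoxRepresentation G ℓ =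
  Σ[ I ∈ Set ] Σ[ B ∈ (I → Box ℓ) ] G ≅ intersectionGraph B

IsBoxicity : SimpleGraph a e → ℕ → Set (lsuc 0ℓ ⊔ a ⊔ e)
IsBoxicity G = IsLeast (λ ℓ → 1 ≤ ℓ × HasBoxRepresentation G ℓ)

{-# OPTIONS --safe #-}
-- Let χ be the number of colours. A colour class has at most d elements: relative to its least
-- element s, its members lie in s + [0, d) or s + (k − d, k), and shifting the second range down
-- by k − d is injective on the class, because two vertices at distance k − d are adjacent.
-- Hence k ≤ χ d, so χ blocks of d consecutive vertices cover the clique. The block starting
-- at s gives one coordinate: in the cyclic order starting at s, the vertex x < d becomes
-- the point x and the vertex x ≥ d becomes [0, x − d]. The intervals of x < y are disjoint
-- exactly when x < d and y − x < d, so adjacent vertices always meet, and a non-adjacent pair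
-- is separated in the coordinate of the block that contains its cyclically first member.
module Submission where

open import Data.Nat
open import Data.Nat.Properties
open import Algebra.Properties.CommutativeSemigroup +-commutativeSemigroup using (xy∙z≈xz∙y)
open import Data.Nat.DivMod using (m<n*o⇒m/o<n; m/n*n≤m; m≡m%n+[m/n]*n; m%n<n)
open import Data.Integer as ℤ using ()
open import Data.Integer.Properties as ℤ using (drop‿+≤+)
open import Data.Fin as Fin using (Fin; toℕ; fromℕ<; combine)
open import Data.Fin.Properties as Fin
  using (toℕ<n; toℕ-fromℕ<; toℕ-injective; toℕ-inject; fromℕ<-injective; combine-injective;
         injective⇒≤; ¬∀⟶∃¬-smallest)
open import Data.Rational as ℚ using (ℚ)
open import Data.Rational.Literals using (fromℤ)
open import Data.Rational.Properties as ℚ using ()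
open import Data.Product using (∃-syntax; _×_; _,_; proj₁; proj₂)
open import Data.Sum using (_⊎_; inj₁; inj₂)
open import Function using (mk⇔; _∘_)
open import Function.Construct.Identity using (↔-id)
open import Relation.Nullary using (yes; no; contradiction)
open import Relation.Nullary.Decidable using (decidable-stable; ¬?)
open import Relation.Binary.Definitions using (tri<; tri≈; tri>)
open import Relation.Binary.PropositionalEquality
open import Defs

private variable
  d k n s u v x y : ℕ

-- Rationals and natural numbers as Dedekind reals.

fromℚ : ℚ → ℝ
fromℚ p = record
  { Lower           = ℚ._< p
  ; Upper           = p ℚ.<_
  ; lower-inhabited = p ℚ.- ℚ.1ℚ , p-1<p
  ; upper-inhabited = p ℚ.+ ℚ.1ℚ , p<p+1
  ; lower-rounded   = λ q → mk⇔ ℚ.<-dense (λ (_ , q<r , r<p) → ℚ.<-trans q<r r<p)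
  ; upper-rounded   = λ q → mk⇔ (λ p<q → let r , p<r , r<q = ℚ.<-dense p<q in r , r<q , p<r)
                               (λ (_ , r<q , p<r) → ℚ.<-trans p<r r<q)
  ; disjoint        = λ q (q<p , p<q) → ℚ.<-irrefl refl (ℚ.<-trans q<p p<q)
  ; located         = located
  }
  where
  p-1<p : p ℚ.- ℚ.1ℚ ℚ.< p
  p-1<p = subst (p ℚ.- ℚ.1ℚ ℚ.<_) (ℚ.+-identityʳ p)
    (ℚ.+-monoʳ-< p (ℚ.negative⁻¹ (ℚ.- ℚ.1ℚ)))

  p<p+1 : p ℚ.< p ℚ.+ ℚ.1ℚ
  p<p+1 = subst (ℚ._< p ℚ.+ ℚ.1ℚ) (ℚ.+-identityʳ p)
    (ℚ.+-monoʳ-< p (ℚ.positive⁻¹ ℚ.1ℚ))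

  located : ∀ {q r} → q ℚ.< r → q ℚ.< p ⊎ p ℚ.< r
  located {q} q<r with q ℚ.<? p
  ... | yes q<p = inj₁ q<p
  ... | no  q≮p = inj₂ (ℚ.≤-<-trans (ℚ.≮⇒≥ q≮p) q<r)

fromℚ-mono : ∀ {p q} → p ℚ.≤ q → fromℚ p ≤ᴿ fromℚ q
fromℚ-mono p≤q _ r<p = ℚ.<-≤-trans r<p p≤q

fromℚ-cancel : ∀ {p q} → fromℚ p ≤ᴿ fromℚ q → p ℚ.≤ q
fromℚ-cancel {p} {q} p≤q = ℚ.≮⇒≥ λ q<p → ℚ.<-irrefl refl (p≤q q q<p)

fromℕ : ℕ → ℝ
fromℕ m = fromℚ (fromℤ (ℤ.+ m))

fromℕ-mono : x ≤ y → fromℕ x ≤ᴿ fromℕ y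
-- Rational order is cross-multiplication, and here both denominators are 1.
fromℕ-mono x≤y = fromℚ-mono (ℚ.*≤* (ℤ.*-monoʳ-≤-nonNeg (ℤ.+ 1) (ℤ.+≤+ x≤y)))

fromℕ-cancel : fromℕ x ≤ᴿ fromℕ y → x ≤ y
fromℕ-cancel x≤y =
  drop‿+≤+ (ℤ.*-cancelʳ-≤-pos _ _ (ℤ.+ 1) (ℚ.drop-*≤* (fromℚ-cancel x≤y)))

-- The intervals of one coordinate, and rotation of the cyclic order.

lo hi : ℕ → ℕ → ℕ
lo d x with x <? d
... | yes _ = x
... | no  _ = 0
hi d x with x <? d
... | yes _ = x
... | no  _ = x ∸ d

lo≤hi : ∀ d x → lo d x ≤ hi d x
lo≤hi d x with x <? d
... | yes _ = ≤-refl
... | no  _ = z≤n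

-- Overlap of two closed intervals through their endpoints in ℕ, which keeps real numbers out of the
-- combinatorics.
record Meet (d x y : ℕ) : Set where
  constructor meet
  field
    lo≤hiʳ : lo d x ≤ hi d y
    lo≤hiˡ : lo d y ≤ hi d x

open Meet

meet-sym : Meet d x y → Meet d y x
meet-sym (meet p q) = meet q p

-- The hypothesis forces `d ≤ y`, so the interval of `y` runs from 0 to at least `x`, while that of
-- `x` starts at or below `x`.
+≤⇒meet : x + d ≤ y → Meet d x y
+≤⇒meet {x} {d} {y} x+d≤y = meet lo≤hi-y lo-y≤hi
  where
  d≤y : d ≤ y
  d≤y = ≤-trans (m≤n+m d x) x+d≤y

  lo≤x : lo d x ≤ x
  lo≤x with x <? d
  ... | yes _ = ≤-refl
  ... | no  _ = z≤n

  lo≤hi-y : lo d x ≤ hi d y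
  lo≤hi-y with y <? d
  ... | yes y<d = contradiction d≤y (<⇒≱ y<d)
  ... | no  _   = ≤-trans lo≤x (m+n≤o⇒m≤o∸n x x+d≤y)

  lo-y≤hi : lo d y ≤ hi d x
  lo-y≤hi with y <? d
  ... | yes y<d = contradiction d≤y (<⇒≱ y<d)
  ... | no  _   = z≤n

-- Here `x` is a single point. Were `y < d`, two distinct points would meet; so `y` has the interval
-- `[0, y ∸ d]`, which must contain `x`.
meet⇒+≤ : x < d → x ≢ y → Meet d x y → x + d ≤ y
meet⇒+≤ {x} {d} {y} x<d x≢y (meet p q) with x <? d | y <? d
... | no x≮d | _       = contradiction x<d x≮d
... | yes _  | yes _   = contradiction (≤-antisym p q) x≢y
... | yes _  | no  y≮d = m≤o∸n⇒m+n≤o x (≮⇒≥ y≮d) p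

-- The position of v in the cyclic order 0, …, k − 1 read from s.
rotate : ℕ → ℕ → ℕ → ℕ
rotate k s v with s ≤? v
... | yes _ = v ∸ s
... | no  _ = v + k ∸ s

-- Adding `s` back removes the truncated subtraction, so gaps can be compared by translation alone.
rotate-spec : ∀ v → s ≤ k →
  (s ≤ v × rotate k s v + s ≡ v) ⊎ (v < s × rotate k s v + s ≡ v + k)
rotate-spec {s} {k} v s≤k with s ≤? v
... | yes s≤v = inj₁ (s≤v , m∸n+n≡m s≤v)
... | no  s≰v = inj₂ (≰⇒> s≰v , m∸n+n≡m (≤-trans s≤k (m≤n+m k v)))

+≤-unshift : x + s ≡ u → y + s ≡ v → u + d ≤ v → x + d ≤ y
+≤-unshift {x} {s} {y = y} {d = d} refl refl le =
  +-cancelʳ-≤ s _ _ (subst (_≤ y + s) (xy∙z≈xz∙y x s d) le)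

+≤-shift : x + s ≡ u → y + s ≡ v → x + d ≤ y → u + d ≤ v
+≤-shift {x} {s} {y = y} {d = d} refl refl le =
  subst (_≤ y + s) (xy∙z≈xz∙y x d s) (+-monoˡ-≤ s le)

-- Adjacency and overlap in a single coordinate.

module _ (k d : ℕ) .{{_ : NonZero d}} (d≤k : d ≤ k) where

  open SimpleGraph (circularClique k d)

  -- Adjacency as a condition on both cyclic arcs, from `i` up to `j` and from `j` on to `i + k`:
  -- each has length at least `d`.
  adj⇒+≤ : ∀ {i j} → toℕ i ≤ toℕ j → Adj i j →
    toℕ i + d ≤ toℕ j × toℕ j + d ≤ toℕ i + k
  adj⇒+≤ {i} {j} i≤j (d≤ , ≤k-d) rewrite m≤n⇒∣m-n∣≡n∸m i≤j =
    subst (_≤ toℕ j) (+-comm d (toℕ i)) (m≤o∸n⇒m+n≤o d i≤j d≤) ,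
    (begin
      toℕ j + d                       ≡⟨ cong (_+ d) (m+[n∸m]≡n i≤j) ⟨
      toℕ i + (toℕ j ∸ toℕ i) + d     ≤⟨ +-monoˡ-≤ d (+-monoʳ-≤ (toℕ i) ≤k-d) ⟩
      toℕ i + (k ∸ d) + d             ≡⟨ +-assoc (toℕ i) (k ∸ d) d ⟩
      toℕ i + (k ∸ d + d)             ≡⟨ cong (toℕ i +_) (m∸n+n≡m d≤k) ⟩
      toℕ i + k                       ∎)
    where open ≤-Reasoning

  +≤⇒adj : ∀ {i j} → toℕ i ≤ toℕ j →
    toℕ i + d ≤ toℕ j → toℕ j + d ≤ toℕ i + k → Adj i j
  +≤⇒adj {i} {j} i≤j p q rewrite m≤n⇒∣m-n∣≡n∸m i≤j =
    m+n≤o⇒m≤o∸n d (subst (_≤ toℕ j) (+-comm (toℕ i) d) p) ,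
    m≤n+o⇒m∸n≤o (toℕ j) (toℕ i)
      (subst (toℕ j ≤_) (+-∸-assoc (toℕ i) d≤k) (m+n≤o⇒m≤o∸n (toℕ j) q))

  Meet-at : ℕ → Fin k → Fin k → Set
  Meet-at s i j = Meet d (rotate k s (toℕ i)) (rotate k s (toℕ j))

  -- Whichever vertex comes first in the order read from `s`, the arc to the other one has length at
  -- least `d`.
  ≤∧adj⇒meet : s ≤ k → ∀ {i j} → toℕ i ≤ toℕ j → Adj i j → Meet-at s i j
  ≤∧adj⇒meet s≤k {i} {j} i≤j adj with adj⇒+≤ i≤j adj
    | rotate-spec (toℕ i) s≤k | rotate-spec (toℕ j) s≤k
  ... | p , q | inj₁ (_ , ei)   | inj₁ (_ , ej)  = +≤⇒meet (+≤-unshift ei ej p)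
  ... | p , q | inj₂ (_ , ei)   | inj₁ (_ , ej)  = meet-sym (+≤⇒meet (+≤-unshift ej ei q))
  ... | p , q | inj₁ (s≤i , _)  | inj₂ (j<s , _) = contradiction (≤-trans s≤i i≤j) (<⇒≱ j<s)
  ... | p , q | inj₂ (_ , ei)   | inj₂ (_ , ej)  =
    +≤⇒meet (+≤-unshift ei ej
      (subst (_≤ toℕ j + k) (xy∙z≈xz∙y (toℕ i) d k) (+-monoˡ-≤ k p)))

  adj⇒meet : s ≤ k → ∀ {i j} → Adj i j → Meet-at s i j
  adj⇒meet s≤k {i} {j} adj with ≤-total (toℕ i) (toℕ j)
  ... | inj₁ i≤j = ≤∧adj⇒meet s≤k i≤j adj
  ... | inj₂ j≤i = meet-sym (≤∧adj⇒meet s≤k j≤i (adj-sym {i} {j} adj))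

  rotate<d : ∀ {s} (i : Fin k) → s ≤ k → s ≤ toℕ i → toℕ i < s + d →
    rotate k s (toℕ i) + s ≡ toℕ i × rotate k s (toℕ i) < d
  rotate<d {s} i s≤k s≤i i<s+d with rotate-spec (toℕ i) s≤k
  ... | inj₂ (i<s , _) = contradiction s≤i (<⇒≱ i<s)
  ... | inj₁ (_ , e)   = e ,
    +-cancelʳ-< s _ _ (subst₂ _<_ (sym e) (+-comm s d) i<s+d)

  meet-later : ∀ {s i j} → s ≤ k → s ≤ toℕ i → toℕ i < s + d → toℕ i < toℕ j →
    Meet-at s i j → toℕ i + d ≤ toℕ j
  meet-later {s} {i} {j} s≤k s≤i i<s+d i<j m
    with rotate<d i s≤k s≤i i<s+d | rotate-spec (toℕ j) s≤k
  ... | _         | inj₂ (j<s , _) = contradiction (<-trans i<j j<s) (≤⇒≯ s≤i)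
  ... | ei , ri<d | inj₁ (_ , ej)  = +≤-shift ei ej (meet⇒+≤ ri<d ri≢rj m)
    where
    ri≢rj : rotate k s (toℕ i) ≢ rotate k s (toℕ j)
    ri≢rj eq = <⇒≢ i<j (trans (sym ei) (trans (cong (_+ s) eq) ej))

  meet-earlier : ∀ {s i j} → s ≤ k → s ≤ toℕ j → toℕ j < s + d → toℕ i < toℕ j →
    Meet-at s i j → toℕ j + d ≤ toℕ i + k
  meet-earlier {s} {i} {j} s≤k s≤j j<s+d i<j m
    with rotate<d j s≤k s≤j j<s+d | rotate-spec (toℕ i) s≤k
  -- Both vertices would lie in one block of `d` consecutive vertices, yet at distance at least `d`.
  ... | _         | inj₁ (s≤i , _) =
    contradiction (meet-later s≤k s≤i (<-trans i<j j<s+d) i<j m)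
      (<⇒≱ (<-≤-trans j<s+d (+-monoˡ-≤ d s≤i)))
  -- Now `i` wraps around and follows `j`, at position `i + k` before the shift by `s`.
  ... | ej , rj<d | inj₂ (_ , ei)  = +≤-shift ej ei (meet⇒+≤ rj<d rj≢ri (meet-sym m))
    where
    rj≢ri : rotate k s (toℕ j) ≢ rotate k s (toℕ i)
    rj≢ri eq = <⇒≢ (<-≤-trans (toℕ<n j) (m≤n+m k (toℕ i)))
      (trans (sym ej) (trans (cong (_+ s) eq) ei))

  -- The box representation given by `n` blocks.

  module _ (k≤n*d : k ≤ n * d) where

    -- The cap keeps `s ≤ k` for rotation when the blocks run past the last vertex.
    start : Fin n → ℕ
    start c = toℕ c * d ⊓ k

    start≤k : ∀ c → start c ≤ k
    start≤k c = m⊓n≤n (toℕ c * d) k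

    /d<n : ∀ (i : Fin k) → toℕ i / d < n
    /d<n i = m<n*o⇒m/o<n {toℕ i} {n} {d} (<-≤-trans (toℕ<n i) k≤n*d)

    block : Fin k → Fin n
    block i = fromℕ< (/d<n i)

    start-block : ∀ i → start (block i) ≡ toℕ i / d * d
    start-block i = trans (cong (λ m → m * d ⊓ k) (toℕ-fromℕ< (/d<n i)))
      (m≤n⇒m⊓n≡m (≤-trans (m/n*n≤m (toℕ i) d) (<⇒≤ (toℕ<n i))))

    start≤ : ∀ i → start (block i) ≤ toℕ i
    start≤ i rewrite start-block i = m/n*n≤m (toℕ i) d

    <start+d : ∀ i → toℕ i < start (block i) + d
    <start+d i rewrite start-block i = begin-strict
      toℕ i                          ≡⟨ m≡m%n+[m/n]*n (toℕ i) d ⟩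
      toℕ i % d + toℕ i / d * d      <⟨ +-monoˡ-< _ (m%n<n (toℕ i) d) ⟩
      d + toℕ i / d * d              ≡⟨ +-comm d _ ⟩
      toℕ i / d * d + d              ∎
      where open ≤-Reasoning

    -- The block of `i` bounds the arc from `i` to `j`, and the block of `j` bounds the arc that
    -- wraps around.
    <∧meet⇒adj : ∀ {i j} → toℕ i < toℕ j → (∀ c → Meet-at (start c) i j) → Adj i j
    <∧meet⇒adj {i} {j} i<j m = +≤⇒adj (<⇒≤ i<j)
      (meet-later (start≤k (block i)) (start≤ i) (<start+d i) i<j (m (block i)))
      (meet-earlier (start≤k (block j)) (start≤ j) (<start+d j) i<j (m (block j)))

    meet⇒adj : ∀ {i j} → i ≢ j → (∀ c → Meet-at (start c) i j) → Adj i j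
    meet⇒adj {i} {j} i≢j m with <-cmp (toℕ i) (toℕ j)
    ... | tri< i<j _ _ = <∧meet⇒adj i<j m
    ... | tri≈ _ i≡j _ = contradiction (toℕ-injective i≡j) i≢j
    ... | tri> _ _ j<i = adj-sym {j} {i} (<∧meet⇒adj j<i (meet-sym ∘ m))

    box : Fin k → Box n
    box i c = record
      { lo    = fromℕ (lo d (rotate k (start c) (toℕ i)))
      ; hi    = fromℕ (hi d (rotate k (start c) (toℕ i)))
      ; lo≤hi = fromℕ-mono (lo≤hi d (rotate k (start c) (toℕ i)))
      }

    meet⇒intersect : ∀ {i j} → (∀ c → Meet-at (start c) i j) → Intersect (box i) (box j)
    meet⇒intersect {i} {j} m =
      -- In each coordinate the larger of the two lower endpoints is a common point.
      (λ c → fromℕ (lo d (rot c i) ⊔ lo d (rot c j))) ,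
      (λ c → fromℕ-mono (m≤m⊔n _ _) , fromℕ-mono (⊔-lub (lo≤hi d (rot c i)) (lo≤hiˡ (m c)))) ,
      (λ c → fromℕ-mono (m≤n⊔m (lo d (rot c i)) _) ,
             fromℕ-mono (⊔-lub (lo≤hiʳ (m c)) (lo≤hi d (rot c j))))
      where
      rot : Fin n → Fin k → ℕ
      rot c i = rotate k (start c) (toℕ i)

    intersect⇒meet : ∀ {i j} → Intersect (box i) (box j) → ∀ c → Meet-at (start c) i j
    intersect⇒meet (p , p∈i , p∈j) c = meet
      (fromℕ-cancel (λ q → proj₂ (p∈j c) q ∘ proj₁ (p∈i c) q))
      (fromℕ-cancel (λ q → proj₂ (p∈i c) q ∘ proj₁ (p∈j c) q))

    hasBoxRepresentation : HasBoxRepresentation (circularClique k d) n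
    hasBoxRepresentation = Fin k , box , ↔-id _ , λ i j → mk⇔
      (λ adj → (λ { refl → adj-irrefl {i} adj }) , meet⇒intersect (λ c → adj⇒meet (start≤k c) adj))
      (λ (i≢j , int) → meet⇒adj i≢j (intersect⇒meet int))

-- The size of colour classes.

leastPreimage : ∀ (f : Fin k → Fin n) i →
  ∃[ s ] (f s ≡ f i × (∀ j → f j ≡ f i → toℕ s ≤ toℕ j))
leastPreimage f i
  -- The least vertex of the class is the smallest failure of `f j ≢ f i`; `i` itself is one
  -- failure.
  with ¬∀⟶∃¬-smallest _ (λ j → f j ≢ f i) (λ j → ¬? (f j Fin.≟ f i)) (λ none → none i refl)
... | s , ¬fs≢fi , below = s , decidable-stable (f s Fin.≟ f i) ¬fs≢fi , least
  where
  least : ∀ j → f j ≡ f i → toℕ s ≤ toℕ j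
  least j fj≡fi = ≮⇒≥ λ j<s →
    below (fromℕ< j<s)
      (trans (cong f (toℕ-injective (trans (toℕ-inject (fromℕ< j<s)) (toℕ-fromℕ< j<s)))) fj≡fi)

module _ (k d : ℕ) .{{_ : NonZero d}} (2d≤k : 2 * d ≤ k) where

  open SimpleGraph (circularClique k d)

  private
    d+d≤k : d + d ≤ k
    d+d≤k = subst (λ m → d + m ≤ k) (+-identityʳ d) 2d≤k

    d≤k : d ≤ k
    d≤k = m+n≤o⇒m≤o d d+d≤k

    d≤k∸d : d ≤ k ∸ d
    d≤k∸d = m+n≤o⇒m≤o∸n d d+d≤k

  fold : ℕ → ℕ
  fold x with x <? d
  ... | yes _ = x
  ... | no  _ = x ∸ (k ∸ d)

  -- Each branch is injective on its range, and a collision across branches means a difference of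
  -- exactly `k ∸ d`. The gap hypotheses make the subtraction exact.
  fold-injective : x ≤ y → y ∸ x ≢ k ∸ d → (d ≤ x → k ∸ d ≤ x) → (d ≤ y → k ∸ d ≤ y) →
    fold x ≡ fold y → x ≡ y
  fold-injective {x} {y} x≤y y∸x≢ x-gap y-gap eq with x <? d | y <? d
  ... | yes _   | yes _   = eq
  ... | yes _   | no  y≮d = contradiction
    (trans (cong (y ∸_) eq) (m∸[m∸n]≡n (y-gap (≮⇒≥ y≮d)))) y∸x≢
  ... | no  x≮d | yes y<d = contradiction (≤-<-trans x≤y y<d) x≮d
  ... | no  x≮d | no  y≮d = ∸-cancelʳ-≡ (x-gap (≮⇒≥ x≮d)) (y-gap (≮⇒≥ y≮d)) eq

  fold<d : x < k → fold x < d
  fold<d {x} x<k with x <? d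
  ... | yes x<d = x<d
  ... | no  _   = m<n+o⇒m∸n<o x (k ∸ d) (subst (x <_) (sym (m∸n+n≡m d≤k)) x<k)

  -- A vertex is determined by its colour and its folded offset from the least vertex of that
  -- colour.
  colorable⇒≤ : Colorable (circularClique k d) n → k ≤ n * d
  colorable⇒≤ {n} (f , proper) = injective⇒≤ {f = λ i → combine (f i) (index i)} injective
    where
    least : Fin k → Fin k
    least i = proj₁ (leastPreimage f i)

    f-least : ∀ i → f (least i) ≡ f i
    f-least i = proj₁ (proj₂ (leastPreimage f i))

    least≤ : ∀ i j → f j ≡ f i → toℕ (least i) ≤ toℕ j
    least≤ i = proj₂ (proj₂ (leastPreimage f i))

    least-cong : ∀ {i j} → f i ≡ f j → least i ≡ least j
    least-cong {i} {j} eq = toℕ-injective (≤-antisym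
      (least≤ i (least j) (trans (f-least j) (sym eq)))
      (least≤ j (least i) (trans (f-least i) eq)))

    offset : Fin k → ℕ
    offset i = toℕ i ∸ toℕ (least i)

    index : Fin k → Fin d
    index i = fromℕ< (fold<d (≤-<-trans (m∸n≤m (toℕ i) (toℕ (least i))) (toℕ<n i)))

    -- An offset from `d` up to `k ∸ d` would make `i` adjacent to the least vertex of its own
    -- colour.
    offset-gap : ∀ i → d ≤ offset i → k ∸ d ≤ offset i
    offset-gap i d≤o = ≮⇒≥ λ o<k∸d →
      proper (least i) i
        (subst (λ m → d ≤ m × m ≤ k ∸ d) (sym (m≤n⇒∣m-n∣≡n∸m (least≤ i i refl))) (d≤o , <⇒≤ o<k∸d))
        (f-least i)

    -- Since `2 * d ≤ k`, the distance `k ∸ d` is at least `d`, so it is a distance between adjacent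
    -- vertices.
    ∸≢ : ∀ {i j} → f i ≡ f j → toℕ i ≤ toℕ j → toℕ j ∸ toℕ i ≢ k ∸ d
    ∸≢ {i} {j} fi≡fj i≤j eq = proper i j
      (subst (λ m → d ≤ m × m ≤ k ∸ d) (sym (trans (m≤n⇒∣m-n∣≡n∸m i≤j) eq)) (d≤k∸d , ≤-refl))
      fi≡fj

    -- Equal colours share their least vertex, so both offsets are measured from one base.
    ordered : ∀ {i j} → toℕ i ≤ toℕ j → f i ≡ f j → fold (offset i) ≡ fold (offset j) → i ≡ j
    ordered {i} {j} i≤j fi≡fj eq = toℕ-injective (∸-cancelʳ-≡ (least≤ i i refl) s≤j
      (trans (fold-injective o≤o gap (offset-gap i) (offset-gap j) eq) same))
      where
      same : offset j ≡ toℕ j ∸ toℕ (least i)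
      same = cong (λ s → toℕ j ∸ toℕ s) (sym (least-cong fi≡fj))

      s≤j : toℕ (least i) ≤ toℕ j
      s≤j = ≤-trans (least≤ i i refl) i≤j

      o≤o : offset i ≤ offset j
      o≤o = subst (offset i ≤_) (sym same) (∸-monoˡ-≤ (toℕ (least i)) i≤j)

      gap : offset j ∸ offset i ≢ k ∸ d
      gap e = ∸≢ fi≡fj i≤j (trans (sym j∸i≡) e)
        where
        j∸i≡ : offset j ∸ offset i ≡ toℕ j ∸ toℕ i
        j∸i≡ = trans (cong (_∸ offset i) same)
          (trans (∸-+-assoc (toℕ j) (toℕ (least i)) (offset i))
            (cong (toℕ j ∸_) (m+[n∸m]≡n (least≤ i i refl))))

    injective : ∀ {i j} → combine (f i) (index i) ≡ combine (f j) (index j) → i ≡ j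
    injective {i} {j} eq with combine-injective (f i) (index i) (f j) (index j) eq
    ... | fi≡fj , ii≡ij with fromℕ<-injective _ _ _ _ ii≡ij | ≤-total (toℕ i) (toℕ j)
    ... | e | inj₁ i≤j = ordered i≤j fi≡fj e
    ... | e | inj₂ j≤i = sym (ordered j≤i (sym fi≡fj) (sym e))

theorem2p2 : (k d : ℕ) .{{_ : NonZero k}} .{{_ : NonZero d}} → k ≥ 2 * d →
    (χ box : ℕ) →
    IsChromaticNumber (circularClique k d) χ →
    IsBoxicity (circularClique k d) box →
    χ ≥ box
theorem2p2 k d 2d≤k χ box (colorable , _) (_ , box-least) =
  box-least χ (1≤χ χ k≤χd , hasBoxRepresentation k d (m+n≤o⇒m≤o d 2d≤k) k≤χd)
  where
  k≤χd : k ≤ χ * d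
  k≤χd = colorable⇒≤ k d 2d≤k colorable

  -- Boxicity ranges over positive dimensions; zero blocks would force `k` to be 0.
  1≤χ : ∀ n → k ≤ n * d → 1 ≤ n
  1≤χ zero    k≤0 = contradiction (n≤0⇒n≡0 k≤0) (≢-nonZero⁻¹ k)
  1≤χ (suc _) _   = s≤s z≤n
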